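{- For every integer $n\ge 1$, $$\mathrm{pf}_n(123,312)=2\binom{n+1}{3}+1.$$
   Context: A Dyck path of semilength $n$ is a lattice path from $(0,0)$ to $(n,n)$ consisting of $n$ north steps $N=(0,1)$ and $n$ east steps $E=(1,0)$ that never goes below the line $y=x$. A parking function of size $n$ is a Dyck path of semilength $n$ whose $n$ north steps are labeled bijectively by $\{1,\dots,n\}$ so that whenever two north steps are consecutive in the path (one immediately following the other), the label of the later one is larger. For a parking function $p$ of size $n$, $\phi(p)$ is the permutation of $\{1,\dots,n\}$ (in one-line notation) obtained by reading the labels of the north steps in the order they occur along the path. A permutation $\pi$ of $\{1,\dots,n\}$ contains a permutation $\rho$ of $\{1,\dots,m\}$ if there are indices $1\le i_1<\cdots<i_m\le n$ such that $\pi_{i_a}\le\pi_{i_b}$ if and only if $\rho_a\le\rho_b$; otherwise $\pi$ avoids $\rho$. For permutations $\rho_1,\dots,\rho_r$, $\mathrm{pf}_n(\rho_1,\dots,\rho_r)$ denotes the number of parking functions $p$ of size $n$ such that $\phi(p)$ avoids each of $\rho_1,\dots,\rho_r$. Binomial coefficients $\binom{a}{b}$ with $0\le a<b$ are $0$. -}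

module Defs where

open import Data.Fin.Base using (Fin; zero; suc; _≤_; _<_)
import Data.Fin.Properties as Fin
open import Data.List.Base
  using (List; []; _∷_; [_]; length; map; filter; inits; lookup; allFin; cartesianProductWith)
open import Data.List.Membership.Propositional using (_∈_; lose)
open import Data.List.Membership.Propositional.Properties
  using (∈-map⁺; ∈-allFin; ∈-filter⁺; ∈-filter⁻; ∈-cartesianProductWith⁺; ∈-map⁻)
open import Data.List.Relation.Unary.All as All using (All; all?; []; _∷_)
open import Data.List.Relation.Unary.AllPairs using ([]; _∷_)
open import Data.List.Relation.Unary.Any using (any?; here; there; satisfied)
open import Data.List.Relation.Unary.Linked using (Linked; linked?)
open import Data.List.Relation.Unary.Unique.Propositional using (Unique)
import Data.List.Relation.Unary.Unique.Propositional.Properties as Unique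
import Data.List.Relation.Unary.Unique.DecPropositional as DecUnique
import Data.List.Membership.DecPropositional as DecMembership
import Data.Nat.Base as ℕ
import Data.Nat.Properties as ℕ
open import Data.Nat.Base using (ℕ; _+_)
open import Data.Product.Base using (∃; _×_; _,_; proj₁; proj₂)
open import Data.Unit.Base using (⊤; tt)
open import Data.Vec.Base as Vec using (Vec; []; _∷_; toList)
open import Data.Vec.Properties using (∷-injective)
open import Function.Base using (_∘_)
open import Function.Bundles using (_⇔_; mk⇔; Equivalence)
open import Relation.Binary.Definitions using () renaming (Decidable to Decidable₂)
open import Relation.Binary.PropositionalEquality using (_≡_; refl)
open import Relation.Nullary using (¬_; Dec; yes; no; ¬?; _×-dec_; _→-dec_)
open import Relation.Nullary.Decidable using (map′; toWitness)
open import Relation.Unary using (Decidable)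

words : {A : Set} → List A → (k : ℕ) → List (Vec A k)
words as ℕ.zero    = [ [] ]
words as (ℕ.suc k) = cartesianProductWith _∷_ as (words as k)

module _ {A : Set} {as : List A} where

  words-complete : (∀ a → a ∈ as) → ∀ {k} (w : Vec A k) → w ∈ words as k
  words-complete a∈as []      = here refl
  words-complete a∈as (a ∷ w) =
    ∈-cartesianProductWith⁺ _∷_ (a∈as a) (words-complete a∈as w)

  words-unique : Unique as → ∀ k → Unique (words as k)
  words-unique as! ℕ.zero    = [] ∷ []
  words-unique as! (ℕ.suc k) =
    Unique.cartesianProductWith⁺ _∷_ ∷-injective as! (words-unique as! k)

-- Permutations of {1,…,n} in one-line notation; the value i is represented by
-- the element of Fin n whose toℕ is i ∸ 1.

IsPermutation : ∀ {n} → List (Fin n) → Set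
IsPermutation xs = Unique xs × (∀ i → i ∈ xs)

isPermutation? : ∀ {n} → Decidable (IsPermutation {n})
isPermutation? xs =
  DecUnique.unique? Fin._≟_ xs ×-dec Fin.all? (λ i → DecMembership._∈?_ Fin._≟_ i xs)

record Permutation (n : ℕ) : Set where
  constructor permutation
  field
    oneLine       : List (Fin n)
    isPermutation : IsPermutation oneLine

open Permutation public

pattern 1′ = zero
pattern 2′ = suc zero
pattern 3′ = suc (suc zero)

π123 : Permutation 3
π123 = permutation (1′ ∷ 2′ ∷ 3′ ∷ []) (toWitness {a? = isPermutation? _} tt)

π312 : Permutation 3
π312 = permutation (3′ ∷ 1′ ∷ 2′ ∷ []) (toWitness {a? = isPermutation? _} tt)

module _ {n m : ℕ} (π : List (Fin n)) (ρ : List (Fin m)) where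

  record IsOccurrence (ι : Vec (Fin (length π)) (length ρ)) : Set where
    constructor occurrence
    field
      increasing      : ∀ a b → a < b → Vec.lookup ι a < Vec.lookup ι b
      orderIsomorphic : ∀ a b →
        lookup π (Vec.lookup ι a) ≤ lookup π (Vec.lookup ι b) ⇔ lookup ρ a ≤ lookup ρ b

  open IsOccurrence public

  isOccurrence? : Decidable IsOccurrence
  isOccurrence? ι =
    map′ (λ (inc , iso) → occurrence inc (λ a b → mk⇔ (proj₁ (iso a b)) (proj₂ (iso a b))))
         (λ o → increasing o , λ a b →
            Equivalence.to (orderIsomorphic o a b) , Equivalence.from (orderIsomorphic o a b))
         (Fin.all? (λ a → Fin.all? λ b → (a Fin.<? b) →-dec (ι! a Fin.<? ι! b))
          ×-dec
          Fin.all? (λ a → Fin.all? λ b →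
            ((π! a Fin.≤? π! b) →-dec (ρ! a Fin.≤? ρ! b)) ×-dec
            ((ρ! a Fin.≤? ρ! b) →-dec (π! a Fin.≤? π! b))))
    where
    ι! = Vec.lookup ι
    π! = lookup π ∘ ι!
    ρ! = lookup ρ

  Contains : Set
  Contains = ∃ IsOccurrence

  contains? : Dec Contains
  contains? =
    map′ satisfied (λ (ι , o) → lose (words-complete ∈-allFin ι) o)
         (any? isOccurrence? (words (allFin (length π)) (length ρ)))

  Avoids : Set
  Avoids = ¬ Contains

  avoids? : Dec Avoids
  avoids? = ¬? contains?

data Step (n : ℕ) : Set where
  N : (label : Fin n) → Step n
  E : Step n

northLabels : ∀ {n} → List (Step n) → List (Fin n)
northLabels []        = []
northLabels (N a ∷ s) = a ∷ northLabels s
northLabels (E ∷ s)   = northLabels s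

norths : ∀ {n} → List (Step n) → ℕ
norths = length ∘ northLabels

easts : ∀ {n} → List (Step n) → ℕ
easts []        = 0
easts (N _ ∷ s) = easts s
easts (E ∷ s)   = ℕ.suc (easts s)

-- After the steps s a path is at the point (easts s , norths s).
WeaklyAboveDiagonal : ∀ {n} → List (Step n) → Set
WeaklyAboveDiagonal s = easts s ℕ.≤ norths s

Ascending : ∀ {n} → Step n → Step n → Set
Ascending (N a) (N b) = a < b
Ascending (N _) E     = ⊤
Ascending E     _     = ⊤

ascending? : ∀ {n} → Decidable₂ (Ascending {n})
ascending? (N a) (N b) = a Fin.<? b
ascending? (N _) E     = yes tt
ascending? E     _     = yes tt

LabelledPath : ℕ → Set
LabelledPath n = Vec (Step n) (n + n)

φ : ∀ {n} → LabelledPath n → List (Fin n)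
φ p = northLabels (toList p)

IsDyckPath : ∀ {n} → LabelledPath n → Set
IsDyckPath {n} p =
  norths (toList p) ≡ n × easts (toList p) ≡ n × All WeaklyAboveDiagonal (inits (toList p))

IsParkingFunction : ∀ {n} → LabelledPath n → Set
IsParkingFunction p = IsDyckPath p × IsPermutation (φ p) × Linked Ascending (toList p)

isParkingFunction? : ∀ {n} → Decidable (IsParkingFunction {n})
isParkingFunction? {n} p =
  ((norths (toList p) ℕ.≟ n) ×-dec (easts (toList p) ℕ.≟ n) ×-dec
    all? (λ s → easts s ℕ.≤? norths s) (inits (toList p)))
  ×-dec isPermutation? (φ p) ×-dec linked? ascending? (toList p)

steps : ∀ n → List (Step n)
steps n = E ∷ map N (allFin n)

parkingFunctions : ∀ n → List (LabelledPath n)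
parkingFunctions n = filter isParkingFunction? (words (steps n) (n + n))

pf : ∀ n → List (∃ Permutation) → ℕ
pf n ρs =
  length (filter (λ p → all? (λ (_ , ρ) → avoids? (φ p) (oneLine ρ)) ρs) (parkingFunctions n))

-- parkingFunctions n lists every parking function of size n exactly once, so
-- that lengths of its filtered sublists are cardinalities.

∈-parkingFunctions : ∀ {n} (p : LabelledPath n) → p ∈ parkingFunctions n ⇔ IsParkingFunction p
∈-parkingFunctions {n} p =
  mk⇔ (proj₂ ∘ ∈-filter⁻ isParkingFunction? {xs = words (steps n) (n + n)})
      (∈-filter⁺ isParkingFunction? (words-complete ∈-steps p))
  where
  ∈-steps : ∀ a → a ∈ steps n
  ∈-steps (N a) = there (∈-map⁺ N (∈-allFin a))
  ∈-steps E     = here refl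

parkingFunctions-unique : ∀ n → Unique (parkingFunctions n)
parkingFunctions-unique n =
  Unique.filter⁺ isParkingFunction?
    (words-unique (E∉ ∷ Unique.map⁺ N-injective (Unique.allFin⁺ n)) (n + n))
  where
  N-injective : ∀ {a b : Fin n} → N a ≡ N b → a ≡ b
  N-injective refl = refl
  E∉ : All (λ s → ¬ E ≡ s) (map N (allFin n))
  E∉ = All.tabulate λ { s∈ refl → E∉map (∈-map⁻ N s∈) }
    where
    E∉map : ¬ ∃ (λ a → a ∈ allFin n × E ≡ N a)
    E∉map (_ , _ , ())

{-# OPTIONS --safe #-}

-- In a permutation avoiding 312 two ascents would produce an occurrence of 123.  So a
-- permutation avoiding both is either decreasing or of the form A B with A and B decreasing and
-- an ascent between them; avoiding 312 then means that the values of A form an interval, and the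
-- ascent means that this interval does not contain the largest value.  If |B| = m + 1, there are
-- m + 1 choices for the smallest value c of A.  In a parking function every descent forces an
-- east step after its upper label, so the path is (NE)ⁿ, except that the east step after the
-- last label of A may be postponed to follow t further pairs NE, where 0 ≤ t ≤ m + 1.  Summing
-- (m + 1)(m + 2) over all m and adding the decreasing permutation gives the formula.

module Submission where

open import Defs
open import Data.Fin.Base using (Fin; zero; suc; _<_; _≤_; _>_; toℕ; fromℕ<)
import Data.Fin.Properties as Fin
open import Data.List.Base
  using (List; []; _∷_; _++_; _∷ʳ_; lookup; length; map; filter; inits; take; drop;
         applyDownFrom; allFin; cartesianProductWith)
open import Data.List.Properties
  using (∷-injective; ∷-injectiveʳ; ∷-injectiveˡ; ∷ʳ-injective; ∷ʳ-++; ++-identityʳ; length-++;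
         length-map; length-take; length-tabulate; length-applyDownFrom; applyDownFrom-∷ʳ;
         take++drop≡id)
open import Data.List.Membership.Propositional using (_∈_)
open import Data.List.Membership.Propositional.Properties
  using (∈-lookup; ∈-++⁺ˡ; ∈-++⁺ʳ; ∈-++⁻; ∈-map⁺; ∈-map⁻; ∈-filter⁺; ∈-filter⁻; ∈-allFin;
         ∈-applyDownFrom⁺; ∈-applyDownFrom⁻; ∈-cartesianProductWith⁺; ∈-cartesianProductWith⁻)
open import Data.List.Membership.Propositional.Properties.WithK using (unique∧set⇒bag)
open import Data.List.Relation.Binary.BagAndSetEquality using (∼bag⇒↭)
open import Data.List.Relation.Binary.Permutation.Propositional.Properties using (↭-length)
open import Data.List.Relation.Unary.All as All using (All; []; _∷_; all?)
import Data.List.Relation.Unary.All.Properties as All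
open import Data.List.Relation.Unary.AllPairs as AllPairs using (AllPairs; []; _∷_)
import Data.List.Relation.Unary.AllPairs.Properties as AllPairs
open import Data.List.Relation.Unary.Any using (here; there; index)
open import Data.List.Relation.Unary.Any.Properties using (lookup-index)
open import Data.List.Relation.Unary.Linked using (Linked; []; [-]; _∷_)
open import Data.List.Relation.Unary.Unique.Propositional using (Unique)
import Data.List.Relation.Unary.Unique.Propositional.Properties as Unique
import Data.Nat.Base as ℕ
open import Data.Nat.Base using (ℕ; zero; suc; z≤n; s≤s; z<s; s<s; _+_; _∸_; _*_; _≥_)
open import Data.Nat.Combinatorics using (_C_; nC1≡n; nCk+nC[k+1]≡[n+1]C[k+1])
open import Data.Nat.DivMod using (_mod_; m<n⇒m%n≡m; m%n<n)
import Data.Nat.Properties as ℕ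
open import Data.Nat.Tactic.RingSolver using (solve-∀)
open import Data.Product.Base using (∃; ∃₂; _×_; _,_; proj₁; proj₂)
open import Data.Sum.Base using (_⊎_; inj₁; inj₂; [_,_]′)
open import Data.Unit.Base using (tt)
open import Data.Vec.Base as Vec using (Vec; []; _∷_; toList; fromList)
import Data.Vec.Properties as Vec
open import Function.Base using (_∘_; id)
open import Function.Bundles using (_⇔_; mk⇔; Equivalence)
open import Relation.Binary.Definitions using (tri<; tri≈; tri>)
open import Relation.Binary.PropositionalEquality
  using (_≡_; refl; sym; trans; cong; cong₂; subst; subst₂; module ≡-Reasoning)
open import Relation.Nullary using (¬_; contradiction; yes; no; _→-dec_)
open import Relation.Nullary.Decidable using (toWitness)
open import Relation.Unary using (Decidable)

-- Avoidance of 123 and 312 as a condition on triples of entries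

data AllTriples {A : Set} (P : A → A → A → Set) : List A → Set where
  []  : AllTriples P []
  _∷_ : ∀ {x xs} → AllPairs (P x) xs → AllTriples P xs → AllTriples P (x ∷ xs)

module _ {A : Set} where

  allPairs-lookup : ∀ {R : A → A → Set} {xs} → AllPairs R xs →
    ∀ {i j} → i < j → R (lookup xs i) (lookup xs j)
  allPairs-lookup (px ∷ _) {zero}  {suc j} _         = All.lookup px (∈-lookup j)
  allPairs-lookup (_ ∷ ps) {suc _} {suc _} (s<s i<j) = allPairs-lookup ps i<j

  allPairs-tabulate : ∀ {R : A → A → Set} xs →
    (∀ {i j} → i < j → R (lookup xs i) (lookup xs j)) → AllPairs R xs
  allPairs-tabulate         []       r = []
  allPairs-tabulate {R = R} (x ∷ xs) r =
    All.tabulate (λ y∈ → subst (R x) (sym (lookup-index y∈)) (r {zero} {suc (index y∈)} z<s))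
    ∷ allPairs-tabulate xs (r ∘ s<s)

  allTriples-lookup : ∀ {P : A → A → A → Set} {xs} → AllTriples P xs →
    ∀ {i j k} → i < j → j < k → P (lookup xs i) (lookup xs j) (lookup xs k)
  allTriples-lookup (px ∷ _) {zero}  {suc _} {suc _} _         (s<s j<k) = allPairs-lookup px j<k
  allTriples-lookup (_ ∷ ps) {suc _} {suc _} {suc _} (s<s i<j) (s<s j<k) =
    allTriples-lookup ps i<j j<k

  allTriples-tabulate : ∀ {P : A → A → A → Set} xs →
    (∀ {i j k} → i < j → j < k → P (lookup xs i) (lookup xs j) (lookup xs k)) → AllTriples P xs
  allTriples-tabulate []       p = []
  allTriples-tabulate (x ∷ xs) p =
    allPairs-tabulate xs (λ j<k → p {zero} z<s (s<s j<k))
    ∷ allTriples-tabulate xs (λ i<j j<k → p (s<s i<j) (s<s j<k))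

AvoidsBoth : ∀ {n} → Fin n → Fin n → Fin n → Set
AvoidsBoth x y z = ¬ (x < y × y < z) × ¬ (y < z × z < x)

module _ {n m : ℕ} {π : List (Fin n)} {ρ : List (Fin m)} where

  -- By trichotomy on the entries of `ρ`: they are distinct, so a tie occurs only at equal
  -- positions, and preserving `<` in both directions settles the rest.
  strictlyMonotone⇒occurrence : ∀ {ι} →
    (∀ a b → lookup ρ a ≡ lookup ρ b → a ≡ b) →
    (∀ a b → a < b → Vec.lookup ι a < Vec.lookup ι b) →
    (∀ a b → lookup ρ a < lookup ρ b → lookup π (Vec.lookup ι a) < lookup π (Vec.lookup ι b)) →
    IsOccurrence π ρ ι
  strictlyMonotone⇒occurrence {ι} inj inc mono = occurrence inc iso
    where
    π! = lookup π ∘ Vec.lookup ι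
    iso : ∀ a b → π! a ≤ π! b ⇔ lookup ρ a ≤ lookup ρ b
    iso a b with Fin.<-cmp (lookup ρ a) (lookup ρ b)
    ... | tri< lt _ _ = mk⇔ (λ _ → ℕ.<⇒≤ lt) (λ _ → ℕ.<⇒≤ (mono a b lt))
    ... | tri≈ _ eq _ with refl ← inj a b eq = mk⇔ (λ _ → ℕ.≤-refl) (λ _ → ℕ.≤-refl)
    ... | tri> _ _ gt = mk⇔ (λ le → contradiction le (ℕ.<⇒≱ (mono b a gt)))
                            (λ le → contradiction le (ℕ.<⇒≱ gt))

  occurrence⇒strictlyMonotone : ∀ {ι} → IsOccurrence π ρ ι →
    ∀ a b → lookup ρ a < lookup ρ b → lookup π (Vec.lookup ι a) < lookup π (Vec.lookup ι b)
  occurrence⇒strictlyMonotone o a b lt =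
    ℕ.≰⇒> (λ le → ℕ.<⇒≱ lt (Equivalence.to (orderIsomorphic o b a) le))

module _ {n : ℕ} {xs : List (Fin n)} {i j k : Fin (length xs)} (i<j : i < j) (j<k : j < k) where

  private
    increasing₃ : ∀ a b → a < b → Vec.lookup (i ∷ j ∷ k ∷ []) a < Vec.lookup (i ∷ j ∷ k ∷ []) b
    increasing₃ 1′ 2′ _ = i<j
    increasing₃ 1′ 3′ _ = Fin.<-trans i<j j<k
    increasing₃ 2′ 3′ _ = j<k
    increasing₃ 2′ 2′ (s<s ())
    increasing₃ 3′ 2′ (s<s ())
    increasing₃ 3′ 3′ (s<s (s<s ()))

  contains-123 : lookup xs i < lookup xs j → lookup xs j < lookup xs k →
    Contains xs (oneLine π123)
  contains-123 x<y y<z = i ∷ j ∷ k ∷ [] , strictlyMonotone⇒occurrence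
    (toWitness {a? = Fin.all? λ a → Fin.all? λ b → (_ Fin.≟ _) →-dec (a Fin.≟ b)} tt)
    increasing₃
    λ { 1′ 2′ _ → x<y
      ; 1′ 3′ _ → Fin.<-trans x<y y<z
      ; 2′ 3′ _ → y<z
      ; 2′ 2′ (s<s ())
      ; 3′ 2′ (s<s ())
      ; 3′ 3′ (s<s (s<s ())) }

  contains-312 : lookup xs j < lookup xs k → lookup xs k < lookup xs i →
    Contains xs (oneLine π312)
  contains-312 y<z z<x = i ∷ j ∷ k ∷ [] , strictlyMonotone⇒occurrence
    (toWitness {a? = Fin.all? λ a → Fin.all? λ b → (_ Fin.≟ _) →-dec (a Fin.≟ b)} tt)
    increasing₃
    λ { 2′ 3′ _ → y<z
      ; 2′ 1′ _ → Fin.<-trans y<z z<x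
      ; 3′ 1′ _ → z<x
      ; 3′ 3′ (s<s ())
      ; 1′ 3′ (s<s ())
      ; 1′ 1′ (s<s (s<s ())) }

-- This trades occurrences, which are vectors of positions, for a condition recursive on the list,
-- so that permutations can be analysed entry by entry.
avoids⇔allTriples : ∀ {n} (xs : List (Fin n)) →
  (Avoids xs (oneLine π123) × Avoids xs (oneLine π312)) ⇔ AllTriples AvoidsBoth xs
avoids⇔allTriples xs = mk⇔
  (λ (a123 , a312) → allTriples-tabulate xs λ i<j j<k →
    (λ (x<y , y<z) → a123 (contains-123 i<j j<k x<y y<z)) ,
    (λ (y<z , z<x) → a312 (contains-312 i<j j<k y<z z<x)))
  (λ ts →
    (λ where
      (i ∷ j ∷ k ∷ [] , o) →
        let mono = occurrence⇒strictlyMonotone o in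
        proj₁ (allTriples-lookup ts (increasing o 1′ 2′ z<s) (increasing o 2′ 3′ (s<s z<s)))
              (mono 1′ 2′ z<s , mono 2′ 3′ (s<s z<s))) ,
    (λ where
      (i ∷ j ∷ k ∷ [] , o) →
        let mono = occurrence⇒strictlyMonotone o in
        proj₂ (allTriples-lookup ts (increasing o 1′ 2′ z<s) (increasing o 2′ 3′ (s<s z<s)))
              (mono 2′ 3′ z<s , mono 3′ 1′ (s<s z<s))))

-- Permutations avoiding both patterns

module _ {A : Set} {R : A → A → Set} where

  allPairs-++⁻ : ∀ xs {ys} → AllPairs R (xs ++ ys) →
    AllPairs R xs × AllPairs R ys × (∀ {x y} → x ∈ xs → y ∈ ys → R x y)
  allPairs-++⁻ []       r        = [] , r , λ ()
  allPairs-++⁻ (x ∷ xs) (px ∷ r) with allPairs-++⁻ xs r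
  ... | rxs , rys , rxy = All.++⁻ˡ xs px ∷ rxs , rys , λ where
    (here refl) y∈ → All.lookup (All.++⁻ʳ xs px) y∈
    (there x∈)  y∈ → rxy x∈ y∈

Decreasing : ∀ {n} → List (Fin n) → Set
Decreasing = AllPairs _>_

module _ {n : ℕ} where

  decreasing⇒unique : ∀ {xs : List (Fin n)} → Decreasing xs → Unique xs
  decreasing⇒unique = AllPairs.map (λ x>y x≡y → Fin.<⇒≢ x>y (sym x≡y))

  -- Each head is the maximum of the common set of entries, so the heads agree; they do not recur in
  -- the tails, so the tails again have the same entries.
  decreasing-≡ : ∀ {xs ys : List (Fin n)} → Decreasing xs → Decreasing ys →
    (∀ {v} → v ∈ xs → v ∈ ys) → (∀ {v} → v ∈ ys → v ∈ xs) → xs ≡ ys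
  decreasing-≡ {[]}     {[]}     _          _          _  _  = refl
  decreasing-≡ {[]}     {y ∷ ys} _          _          _  ⊇  with () ← ⊇ (here refl)
  decreasing-≡ {x ∷ xs} {[]}     _          _          ⊆  _  with () ← ⊆ (here refl)
  decreasing-≡ {x ∷ xs} {y ∷ ys} (x> ∷ xs↘) (y> ∷ ys↘) ⊆  ⊇  =
    cong₂ _∷_ x≡y (decreasing-≡ xs↘ ys↘
      (λ v∈ → tail (All.lookup x> v∈) x≡y (⊆ (there v∈)))
      (λ v∈ → tail (All.lookup y> v∈) (sym x≡y) (⊇ (there v∈))))
    where
    heads : x ∈ y ∷ ys → y ∈ x ∷ xs → x ≡ y
    heads (here x≡y) _          = x≡y
    heads (there _)  (here y≡x) = sym y≡x
    heads (there x∈) (there y∈) =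
      contradiction (All.lookup y> x∈) (Fin.<-asym (All.lookup x> y∈))
    x≡y : x ≡ y
    x≡y = heads (⊆ (here refl)) (⊇ (here refl))
    tail : ∀ {a b v : Fin n} {zs} → v < a → a ≡ b → v ∈ b ∷ zs → v ∈ zs
    tail v<a refl (here refl) = contradiction v<a (Fin.<-irrefl refl)
    tail _   _    (there v∈)  = v∈

  -- Both patterns end in an ascent, so no entry in front completes a descent to an occurrence.
  decreasing⇒allPairs-avoidsBoth : ∀ {x} {ys : List (Fin n)} → Decreasing ys →
    AllPairs (AvoidsBoth x) ys
  decreasing⇒allPairs-avoidsBoth = AllPairs.map λ y>z →
    (λ (_ , y<z) → Fin.<-asym y<z y>z) , (λ (y<z , _) → Fin.<-asym y<z y>z)

  -- If the two lists are disjoint and together exhaust `Fin n`, this makes the values of `xs` an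
  -- interval.
  Convex : List (Fin n) → List (Fin n) → Set
  Convex xs ys = ∀ {x x′ y} → x ∈ xs → x′ ∈ xs → y ∈ ys → x < y → x′ < y

  -- A triple whose last two entries lie in the same list ends in a descent. Otherwise its first two
  -- lie in `xs`: they descend, which excludes 123, and a 312 would put the third between them in
  -- value.
  convex⇒allTriples : ∀ {xs ys} → Decreasing xs → Decreasing ys → Convex xs ys →
    AllTriples AvoidsBoth (xs ++ ys)
  convex⇒allTriples {[]} {[]}     _ _          _  = []
  convex⇒allTriples {[]} {y ∷ ys} _ (_ ∷ ys↘) cv =
    decreasing⇒allPairs-avoidsBoth ys↘ ∷ convex⇒allTriples [] ys↘ λ ()
  convex⇒allTriples {x ∷ xs} (x> ∷ xs↘) ys↘ cv =
    AllPairs.++⁺ (decreasing⇒allPairs-avoidsBoth xs↘) (decreasing⇒allPairs-avoidsBoth ys↘)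
      (All.tabulate λ y∈ → All.tabulate λ z∈ →
        (λ (x<y , _) → Fin.<-asym x<y (All.lookup x> y∈)) ,
        (λ (y<z , z<x) → Fin.<-asym z<x (cv (there y∈) (here refl) z∈ y<z)))
    ∷ convex⇒allTriples xs↘ ys↘ (λ x∈ x′∈ → cv (there x∈) (there x′∈))

  -- The list A of the outline is `front ∷ʳ bottom`, and B is `top ∷ rest`. A is split at its end
  -- because `bottom` is the label whose east step may be postponed.
  record OneAscent (xs : List (Fin n)) : Set where
    constructor oneAscent
    field
      front           : List (Fin n)
      bottom top      : Fin n
      rest            : List (Fin n)
      split           : xs ≡ (front ∷ʳ bottom) ++ top ∷ rest
      frontDecreasing : Decreasing (front ∷ʳ bottom)
      backDecreasing  : Decreasing (top ∷ rest)
      ascent          : bottom < top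
      convex          : Convex (front ∷ʳ bottom) (top ∷ rest)

  -- Induction, putting x in front. Before a decreasing list, x either prolongs it or creates the
  -- ascent; if the ascent is already there, x has to prolong A.
  allTriples⇒decreasing⊎oneAscent : ∀ {xs : List (Fin n)} → Unique xs →
    AllTriples AvoidsBoth xs → Decreasing xs ⊎ OneAscent xs
  allTriples⇒decreasing⊎oneAscent {[]} _ _ = inj₁ []
  allTriples⇒decreasing⊎oneAscent {x ∷ xs} (x∉ ∷ xs!) (px ∷ pxs)
    with allTriples⇒decreasing⊎oneAscent xs! pxs
  ... | inj₁ [] = inj₁ ([] ∷ [])
  ... | inj₁ ys↘@(_∷_ {y} {ys} y> _) with Fin.<-cmp x y
  ...   | tri< x<y _ _ = inj₂ (oneAscent [] x y ys refl ([] ∷ []) ys↘ x<y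
                                λ { (here refl) (here refl) _ x<z → x<z })
  ...   | tri≈ _ x≡y _ = contradiction x≡y (All.head x∉)
  ...   | tri> _ _ x>y = inj₁ ((x>y ∷ All.map (λ z<y → Fin.<-trans z<y x>y) y>) ∷ ys↘)
  allTriples⇒decreasing⊎oneAscent {x ∷ _} (x∉ ∷ _) (px ∷ _)
      | inj₂ (oneAscent front c b rest refl A↘ B↘ c<b cv) =
    inj₂ (oneAscent (x ∷ front) c b rest refl (All.tabulate <x ∷ A↘) B↘ c<b cv′)
    where
    A = front ∷ʳ c
    B = b ∷ rest
    -- Given y < z, the entries x y z form a 123 if x < y and a 312 if z < x.
    between : ∀ {y z} → y ∈ A → z ∈ B → y < z → y < x × x < z
    between {y} {z} y∈ z∈ y<z = y<x , x<z
      where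
      avoids = proj₂ (proj₂ (allPairs-++⁻ A px)) y∈ z∈
      y<x : y < x
      y<x = Fin.≤∧≢⇒< (ℕ.≮⇒≥ λ x<y → proj₁ avoids (x<y , y<z))
                        (λ y≡x → All.lookup x∉ (∈-++⁺ˡ y∈) (sym y≡x))
      x<z : x < z
      x<z = Fin.≤∧≢⇒< (ℕ.≮⇒≥ λ z<x → proj₂ avoids (y<z , z<x))
                        (All.lookup x∉ (∈-++⁺ʳ A z∈))
    <x : ∀ {y} → y ∈ A → y < x
    -- Convexity spreads the ascent c < b to every y in A, so `between` applies with z = b.
    <x y∈ = proj₁ (between y∈ (here refl) (cv (∈-++⁺ʳ front (here refl)) y∈ (here refl) c<b))
    cv′ : Convex (x ∷ A) B
    cv′ (here refl) (here refl) _  x<z = x<z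
    cv′ (here refl) (there y∈)  _  x<z = Fin.<-trans (<x y∈) x<z
    cv′ (there y∈)  (here refl) z∈ y<z = proj₂ (between y∈ z∈ y<z)
    cv′ (there y∈)  (there y′∈) z∈ y<z = cv y∈ y′∈ z∈ y<z

  decreasing-∷ʳ-≥ : ∀ xs {c : Fin n} → Decreasing (xs ∷ʳ c) → ∀ {y} → y ∈ xs ∷ʳ c → c ≤ y
  decreasing-∷ʳ-≥ []       _          (here refl) = ℕ.≤-refl
  decreasing-∷ʳ-≥ (x ∷ xs) (x> ∷ _)   (here refl) =
    ℕ.<⇒≤ (All.lookup x> (∈-++⁺ʳ xs (here refl)))
  decreasing-∷ʳ-≥ (x ∷ xs) (_ ∷ xs↘) (there y∈)  = decreasing-∷ʳ-≥ xs xs↘ y∈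

  decreasing-∷ʳ-max : ∀ xs {c : Fin n} → Decreasing (xs ∷ʳ c) →
    ∃ λ d → d ∈ xs ∷ʳ c × (∀ {y} → y ∈ xs ∷ʳ c → y ≤ d)
  decreasing-∷ʳ-max []       _         = _ , here refl , λ { (here refl) → ℕ.≤-refl }
  decreasing-∷ʳ-max (x ∷ xs) (x> ∷ _) = x , here refl , λ where
    (here refl) → ℕ.≤-refl
    (there y∈)  → ℕ.<⇒≤ (All.lookup x> y∈)

-- Normal form of the permutations with one ascent

module _ {p : ℕ} where

  -- Reducing modulo `suc p` lets the lists below be defined for all parameters; bounds enter only
  -- in the lemmas about them.
  fin : ℕ → Fin (suc p)
  fin = _mod suc p

  toℕ-fin : ∀ {i} → i ℕ.< suc p → toℕ (fin i) ≡ i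
  toℕ-fin {i} i< = trans (Fin.toℕ-fromℕ< (m%n<n i (suc p))) (m<n⇒m%n≡m i<)

  -- Within bounds, the interval from c to k + c, upper end excluded, in decreasing order.
  desc : ℕ → ℕ → List (Fin (suc p))
  desc c = applyDownFrom (λ i → fin (i + c))

  ∈-desc⁺ : ∀ c k {v} → c ℕ.≤ toℕ v → toℕ v ℕ.< k + c → v ∈ desc c k
  ∈-desc⁺ c k {v} c≤v v<k+c = subst (_∈ desc c k) v≡
    (∈-applyDownFrom⁺ _ (ℕ.+-cancelʳ-< c _ _ (subst (ℕ._< k + c) (sym (ℕ.m∸n+n≡m c≤v)) v<k+c)))
    where
    v≡ : fin ((toℕ v ∸ c) + c) ≡ v
    v≡ = Fin.toℕ-injective (trans (cong (toℕ ∘ fin) (ℕ.m∸n+n≡m c≤v)) (toℕ-fin (Fin.toℕ<n v)))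

  ∈-desc⁻ : ∀ c k {v} → k + c ℕ.≤ suc p → v ∈ desc c k → c ℕ.≤ toℕ v × toℕ v ℕ.< k + c
  ∈-desc⁻ c k k+c≤ v∈ with i , i<k , refl ← ∈-applyDownFrom⁻ _ v∈ =
    subst (λ w → c ℕ.≤ w × w ℕ.< k + c) (sym (toℕ-fin (ℕ.<-≤-trans i+c<k+c k+c≤)))
      (ℕ.m≤n+m c i , i+c<k+c)
    where i+c<k+c = ℕ.+-monoˡ-< c i<k

  desc-decreasing : ∀ c k → k + c ℕ.≤ suc p → Decreasing (desc c k)
  desc-decreasing c k k+c≤ = AllPairs.applyDownFrom⁺₁ _ k λ j<i i<k →
    let i+c< = ℕ.<-≤-trans (ℕ.+-monoˡ-< c i<k) k+c≤
        j+c< = ℕ.+-monoˡ-< c j<i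
    in subst₂ ℕ._<_ (sym (toℕ-fin (ℕ.<-trans j+c< i+c<))) (sym (toℕ-fin i+c<)) j+c<

  -- With j = p ∸ suc m, A consists of the j + 1 values from c on, leaving m + 1 of the p + 1 labels
  -- for B. This list is A without its last entry c.
  front : ℕ → ℕ → List (Fin (suc p))
  front m c = applyDownFrom (λ i → fin (suc i + c)) (p ∸ suc m)

  low : ℕ → ℕ → List (Fin (suc p))
  low m c = desc c (suc (p ∸ suc m))

  -- The values above A, then the c values below it. The `suc` in the first length keeps at least
  -- one value above A, so an ascent follows c.
  back : ℕ → ℕ → List (Fin (suc p))
  back m c = desc (suc (p ∸ suc m) + c) (suc (m ∸ c)) ++ desc 0 c

  front-∷ʳ : ∀ m c → front m c ∷ʳ fin c ≡ low m c
  front-∷ʳ m c = applyDownFrom-∷ʳ (λ i → fin (i + c)) (p ∸ suc m)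

  length-front : ∀ m c → length (front m c) ≡ p ∸ suc m
  length-front m c = length-applyDownFrom (λ i → fin (suc i + c)) (p ∸ suc m)

  module _ {m c : ℕ} (m<p : m ℕ.< p) (c≤m : c ℕ.≤ m) where

    private
      j a l : ℕ
      j = p ∸ suc m
      a = suc j + c
      l = suc (m ∸ c)

      upper : suc (m ∸ c) + (suc j + c) ≡ suc p
      upper = begin
        suc (m ∸ c) + (suc j + c) ≡⟨ cong (suc (m ∸ c) +_) (ℕ.+-comm (suc j) c) ⟩
        suc (m ∸ c) + (c + suc j) ≡⟨ ℕ.+-assoc (suc (m ∸ c)) c (suc j) ⟨
        suc (m ∸ c + c) + suc j   ≡⟨ cong (λ k → suc k + suc j) (ℕ.m∸n+n≡m c≤m) ⟩
        suc m + suc j             ≡⟨ ℕ.+-suc (suc m) j ⟩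
        suc (suc m + j)           ≡⟨ cong suc (ℕ.m+[n∸m]≡n m<p) ⟩
        suc p                     ∎
        where open ≡-Reasoning

      low≤ : suc j + c ℕ.≤ suc p
      low≤ = subst (suc j + c ℕ.≤_) upper (ℕ.m≤n+m _ (suc (m ∸ c)))

      c≤ : c + 0 ℕ.≤ suc p
      c≤ = ℕ.≤-trans (ℕ.≤-reflexive (ℕ.+-identityʳ c)) (ℕ.≤-trans (ℕ.m≤n+m c (suc j)) low≤)

    low-decreasing : Decreasing (low m c)
    low-decreasing = desc-decreasing c (suc j) low≤

    ∈-low⁻ : ∀ {v} → v ∈ low m c → c ℕ.≤ toℕ v × toℕ v ℕ.< suc j + c
    ∈-low⁻ = ∈-desc⁻ c (suc j) low≤

    ∈-back⁻ : ∀ {v} → v ∈ back m c → suc j + c ℕ.≤ toℕ v ⊎ toℕ v ℕ.< c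
    ∈-back⁻ v∈ with ∈-++⁻ (desc a l) v∈
    ... | inj₁ v∈ = inj₁ (proj₁ (∈-desc⁻ a l (ℕ.≤-reflexive upper) v∈))
    ... | inj₂ v∈ = inj₂ (subst (_ ℕ.<_) (ℕ.+-identityʳ c) (proj₂ (∈-desc⁻ 0 c c≤ v∈)))

    low⊎back : ∀ v → v ∈ low m c ⊎ v ∈ back m c
    low⊎back v with toℕ v ℕ.<? c
    ... | yes v<c = inj₂ (∈-++⁺ʳ (desc a l)
                            (∈-desc⁺ 0 c z≤n (subst (_ ℕ.<_) (sym (ℕ.+-identityʳ c)) v<c)))
    ... | no v≮c with toℕ v ℕ.<? suc j + c
    ...   | yes v< = inj₁ (∈-desc⁺ c (suc j) (ℕ.≮⇒≥ v≮c) v<)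
    ...   | no  v≮ = inj₂ (∈-++⁺ˡ (∈-desc⁺ a l (ℕ.≮⇒≥ v≮)
                             (subst (toℕ v ℕ.<_) (sym upper) (Fin.toℕ<n v))))

    low-back-disjoint : ∀ {v} → v ∈ low m c → ¬ v ∈ back m c
    low-back-disjoint v∈low v∈back with ∈-low⁻ v∈low | ∈-back⁻ v∈back
    ... | _   , v< | inj₁ ≤v  = ℕ.<⇒≱ v< ≤v
    ... | c≤v , _  | inj₂ v<c = ℕ.<⇒≱ v<c c≤v

    back-decreasing : Decreasing (back m c)
    back-decreasing = AllPairs.++⁺ (desc-decreasing a l (ℕ.≤-reflexive upper)) (desc-decreasing 0 c c≤)
      (All.tabulate λ x∈ → All.tabulate λ y∈ →
        ℕ.<-≤-trans (subst (_ ℕ.<_) (ℕ.+-identityʳ c) (proj₂ (∈-desc⁻ 0 c c≤ y∈)))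
          (ℕ.≤-trans (ℕ.m≤n+m c (suc j)) (proj₁ (∈-desc⁻ a l (ℕ.≤-reflexive upper) x∈))))

    low-back-convex : Convex (low m c) (back m c)
    low-back-convex x∈ x′∈ y∈ x<y with ∈-back⁻ y∈
    ... | inj₁ ≤y  = ℕ.<-≤-trans (proj₂ (∈-low⁻ x′∈)) ≤y
    ... | inj₂ y<c = contradiction (ℕ.<-trans x<y y<c) (ℕ.≤⇒≯ (proj₁ (∈-low⁻ x∈)))

    low-back-isPermutation : IsPermutation (low m c ++ back m c)
    low-back-isPermutation =
      Unique.++⁺ (decreasing⇒unique low-decreasing) (decreasing⇒unique back-decreasing)
        (λ (v∈low , v∈back) → low-back-disjoint v∈low v∈back) ,
      λ v → [ ∈-++⁺ˡ , ∈-++⁺ʳ (low m c) ]′ (low⊎back v)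

    low-back-allTriples : AllTriples AvoidsBoth (low m c ++ back m c)
    low-back-allTriples = convex⇒allTriples low-decreasing back-decreasing low-back-convex

    length-back : length (back m c) ≡ suc m
    length-back = begin
      length (back m c) ≡⟨ length-++ (desc a l) ⟩
      length (desc a l) + length (desc 0 c)
                        ≡⟨ cong₂ _+_ (length-applyDownFrom (λ i → fin (i + a)) l)
                                     (length-applyDownFrom (λ i → fin (i + 0)) c) ⟩
      suc (m ∸ c) + c   ≡⟨ cong suc (ℕ.m∸n+n≡m c≤m) ⟩
      suc m             ∎
      where open ≡-Reasoning

    -- The part of `back` above A is nonempty and starts with the largest label p.
    back-ascent : ∀ {y ys} → back m c ≡ y ∷ ys → fin c < y
    back-ascent refl = subst₂ ℕ._<_ (sym (toℕ-fin c<)) (sym (toℕ-fin (ℕ.≤-reflexive upper)))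
      (ℕ.<-≤-trans (s≤s (ℕ.m≤n+m c j)) (ℕ.m≤n+m (suc j + c) (m ∸ c)))
      where
      c< : c ℕ.< suc p
      c< = ℕ.<-≤-trans (s≤s (ℕ.m≤n+m c j)) low≤

  record LowBack {xs : List (Fin (suc p))} (o : OneAscent xs) : Set where
    constructor lowBack
    open OneAscent o hiding (front)
    field
      m c     : ℕ
      m<p     : m ℕ.< p
      c≤m     : c ℕ.≤ m
      bottom≡ : bottom ≡ fin c
      front≡  : OneAscent.front o ≡ front m c
      back≡   : top ∷ rest ≡ back m c

  -- By convexity A is the interval from its last entry to its maximum d, and B is the complement;
  -- both are decreasing, so `decreasing-≡` identifies them.
  oneAscent⇒lowBack : ∀ {xs} → IsPermutation xs → (o : OneAscent xs) → LowBack o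
  oneAscent⇒lowBack {xs} (xs! , xs-complete) o@(oneAscent F bot top rest refl A↘ B↘ bot<top cv)
    with d , d∈ , ≤d ← decreasing-∷ʳ-max F A↘ =
    lowBack m c m<p c≤m (proj₂ F,bot) (proj₁ F,bot) B≡
    where
    c = toℕ bot
    j = toℕ d ∸ c
    -- A has j + 1 of the p + 1 labels, so m + 1 = p - j remain for B.
    m = p ∸ suc j
    A = F ∷ʳ bot
    B = top ∷ rest

    bot∈ : bot ∈ A
    bot∈ = ∈-++⁺ʳ F (here refl)

    -- Convexity carries the ascent from `bot` over to d, so d is below `top`, which is at most p.
    d<p : toℕ d ℕ.< p
    d<p = ℕ.<-≤-trans (cv bot∈ d∈ (here refl) bot<top) (ℕ.s≤s⁻¹ (Fin.toℕ<n top))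

    j+c≡d : j + c ≡ toℕ d
    j+c≡d = ℕ.m∸n+n≡m (≤d bot∈)

    m+j≡p : suc m + j ≡ p
    m+j≡p = trans (sym (ℕ.+-suc m j))
      (ℕ.m∸n+n≡m (ℕ.≤-trans (s≤s (ℕ.m∸n≤m (toℕ d) c)) d<p))

    m<p : m ℕ.< p
    m<p = subst (suc m ℕ.≤_) m+j≡p (ℕ.m≤m+n (suc m) j)

    c≤m : c ℕ.≤ m
    c≤m = ℕ.m+n≤o⇒m≤o∸n c
      (subst (ℕ._≤ p) (trans (cong suc (sym j+c≡d)) (ℕ.+-comm (suc j) c)) d<p)

    j≡ : p ∸ suc m ≡ j
    j≡ = trans (cong (_∸ suc m) (sym m+j≡p)) (ℕ.m+n∸m≡n (suc m) j)

    top≡ : suc (p ∸ suc m) + c ≡ suc (toℕ d)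
    top≡ = cong suc (trans (cong (_+ c) j≡) j+c≡d)

    A≡ : A ≡ low m c
    A≡ = decreasing-≡ A↘ (low-decreasing m<p c≤m)
      (λ {y} y∈ → ∈-desc⁺ c (suc (p ∸ suc m)) (decreasing-∷ʳ-≥ F A↘ y∈)
                (subst (toℕ y ℕ.<_) (sym top≡) (s≤s (≤d y∈))))
      λ {v} v∈ → low⊆A (∈-low⁻ m<p c≤m v∈) (∈-++⁻ A (xs-complete v))
      where
      low⊆A : ∀ {v} → c ℕ.≤ toℕ v × toℕ v ℕ.< suc (p ∸ suc m) + c → v ∈ A ⊎ v ∈ B → v ∈ A
      low⊆A _ (inj₁ v∈A) = v∈A
      low⊆A {v} (c≤v , v<) (inj₂ v∈B) with bot Fin.≟ v
      ... | yes refl = bot∈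
      -- An entry of B above `bot` is above d too, hence outside the interval.
      ... | no bot≢v = contradiction (cv bot∈ d∈ v∈B (Fin.≤∧≢⇒< c≤v bot≢v))
                         (ℕ.≤⇒≯ (ℕ.s≤s⁻¹ (subst (toℕ v ℕ.<_) top≡ v<)))

    B≡ : B ≡ back m c
    B≡ = decreasing-≡ B↘ (back-decreasing m<p c≤m)
      (λ {v} v∈B → [ (λ v∈low → contradiction refl
                        (proj₂ (proj₂ (allPairs-++⁻ A xs!)) (subst (v ∈_) (sym A≡) v∈low) v∈B))
                   , id ]′ (low⊎back m<p c≤m v))
      (λ {v} v∈back → [ (λ v∈A → contradiction v∈back
                           (low-back-disjoint m<p c≤m (subst (v ∈_) A≡ v∈A)))
                      , id ]′ (∈-++⁻ A (xs-complete v)))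

    F,bot : F ≡ front m c × bot ≡ fin c
    F,bot = ∷ʳ-injective F (front m c) (trans A≡ (sym (front-∷ʳ m c)))

-- Labelled paths

module _ {n : ℕ} where

  -- The index is the height above the diagonal at which the steps start. East steps need it
  -- positive and the end needs it zero, so pattern matching does the work of the condition on all
  -- prefixes.
  data Path : ℕ → List (Step n) → Set where
    []    : Path 0 []
    north : ∀ {h a s} → Path (suc h) s → Path h (N a ∷ s)
    east  : ∀ {h s} → Path h s → Path (suc h) (E ∷ s)

  -- For h = 0 this is `WeaklyAboveDiagonal`; other heights arise in the induction along the path.
  AboveFrom : ℕ → List (Step n) → Set
  AboveFrom h s = easts s ℕ.≤ h + norths s

  path⁻ : ∀ {h s} → Path h s → easts s ≡ h + norths s × All (AboveFrom h) (inits s)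
  path⁻ []                = refl , z≤n ∷ []
  path⁻ {h} {N _ ∷ s} (north q) with path⁻ q
  ... | eq , above = trans eq (sym (ℕ.+-suc h (norths s))) , z≤n ∷ All.map⁺
    (All.map (λ {r} → subst (easts r ℕ.≤_) (sym (ℕ.+-suc h (norths r)))) above)
  path⁻ (east q) with path⁻ q
  ... | eq , above = cong suc eq , z≤n ∷ All.map⁺ (All.map s≤s above)

  path⁺ : ∀ {h s} → easts s ≡ h + norths s → All (AboveFrom h) (inits s) → Path h s
  path⁺ {zero}  {[]}      _  _            = []
  path⁺ {h}     {N _ ∷ s} eq (_ ∷ above) =
    north (path⁺ (trans eq (ℕ.+-suc h (norths s)))
      (All.map (λ {r} → subst (easts r ℕ.≤_) (ℕ.+-suc h (norths r))) (All.map⁻ above)))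
  -- The prefix consisting of this east step alone is already below the diagonal.
  path⁺ {zero}  {E ∷ _}   _  (_ ∷ () ∷ _)
  path⁺ {suc h} {E ∷ _}   eq (_ ∷ above)  =
    east (path⁺ (ℕ.suc-injective eq) (All.map ℕ.s≤s⁻¹ (All.map⁻ above)))

  length-steps : ∀ (s : List (Step n)) → length s ≡ norths s + easts s
  length-steps []        = refl
  length-steps (N _ ∷ s) = cong suc (length-steps s)
  length-steps (E ∷ s)   = trans (cong suc (length-steps s)) (sym (ℕ.+-suc (norths s) (easts s)))

  northLabels-++ : ∀ (s : List (Step n)) {t} → northLabels (s ++ t) ≡ northLabels s ++ northLabels t
  northLabels-++ []        = refl
  northLabels-++ (N a ∷ s) = cong (a ∷_) (northLabels-++ s)
  northLabels-++ (E ∷ s)   = northLabels-++ s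

  zigzag : List (Fin n) → List (Step n)
  zigzag []       = []
  zigzag (a ∷ as) = N a ∷ E ∷ zigzag as

  -- The zigzag on the labels F, c, G, H with the east step after c postponed until after G.
  bump : List (Fin n) → Fin n → List (Fin n) → List (Fin n) → List (Step n)
  bump F c G H = zigzag F ++ N c ∷ zigzag G ++ E ∷ zigzag H

  northLabels-zigzag : ∀ F → northLabels (zigzag F) ≡ F
  northLabels-zigzag []      = refl
  northLabels-zigzag (a ∷ F) = cong (a ∷_) (northLabels-zigzag F)

  northLabels-bump : ∀ F {c} G {H} → northLabels (bump F c G H) ≡ F ++ c ∷ G ++ H
  northLabels-bump F {c} G {H} = trans (northLabels-++ (zigzag F))
    (cong₂ (λ f gh → f ++ c ∷ gh) (northLabels-zigzag F)
      (trans (northLabels-++ (zigzag G)) (cong₂ _++_ (northLabels-zigzag G) (northLabels-zigzag H))))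

  path-zigzag-++ : ∀ F {h s} → Path h s → Path h (zigzag F ++ s)
  path-zigzag-++ []      q = q
  path-zigzag-++ (_ ∷ F) q = north (east (path-zigzag-++ F q))

  path-zigzag : ∀ F → Path 0 (zigzag F)
  path-zigzag []      = []
  path-zigzag (_ ∷ F) = north (east (path-zigzag F))

  path-bump : ∀ F {c} G {H} → Path 0 (bump F c G H)
  path-bump F G {H} = path-zigzag-++ F (north (path-zigzag-++ G (east (path-zigzag H))))

  linked-E∷ : ∀ {s : List (Step n)} → Linked Ascending s → Linked Ascending (E ∷ s)
  linked-E∷ {[]}    _ = [-]
  linked-E∷ {_ ∷ _} l = tt ∷ l

  linked-zigzag-++ : ∀ F {s} → Linked Ascending s → Linked Ascending (zigzag F ++ s)
  linked-zigzag-++ []      l = l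
  linked-zigzag-++ (_ ∷ F) l = tt ∷ linked-E∷ (linked-zigzag-++ F l)

  linked-zigzag : ∀ F → Linked Ascending (zigzag F)
  linked-zigzag F = subst (Linked Ascending) (++-identityʳ (zigzag F)) (linked-zigzag-++ F [])

  -- Only c can be followed directly by a north step. The hypothesis concerns `G ++ H` because this
  -- list is the same for every length of the postponement.
  linked-bump : ∀ F {c} G {H} → (∀ {y ys} → G ++ H ≡ y ∷ ys → c < y) →
    Linked Ascending (bump F c G H)
  linked-bump F {c} G {H} c< = linked-zigzag-++ F (linked-N∷ G c<)
    where
    lH : ∀ G → Linked Ascending (zigzag G ++ E ∷ zigzag H)
    lH G = linked-zigzag-++ G (linked-E∷ (linked-zigzag H))
    linked-N∷ : ∀ G → (∀ {y ys} → G ++ H ≡ y ∷ ys → c < y) →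
      Linked Ascending (N c ∷ zigzag G ++ E ∷ zigzag H)
    linked-N∷ []      _  = tt ∷ lH []
    linked-N∷ (g ∷ G) c< = c< refl ∷ lH (g ∷ G)

  -- Two consecutive north steps would have ascending labels, so each north step is followed by an
  -- east step, back to the diagonal.
  decreasing⇒zigzag : ∀ {s} → Path 0 s → Linked Ascending s → Decreasing (northLabels s) →
    s ≡ zigzag (northLabels s)
  decreasing⇒zigzag []                _         _                = refl
  decreasing⇒zigzag (north (east q))  (_ ∷ [-]) _          with [] ← q = refl
  decreasing⇒zigzag (north (east q))  (_ ∷ _ ∷ l) (_ ∷ d) =
    cong (λ s → N _ ∷ E ∷ s) (decreasing⇒zigzag q l d)
  decreasing⇒zigzag (north (north _)) (a<b ∷ _) ((b<a ∷ _) ∷ _) =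
    contradiction b<a (Fin.<-asym a<b)

  linked-tail : ∀ {x} {s : List (Step n)} → Linked Ascending (x ∷ s) → Linked Ascending s
  linked-tail [-]     = []
  linked-tail (_ ∷ l) = l

  -- As before, north steps come in pairs NE, now one unit above the diagonal, until the one surplus
  -- east step separates G from H.
  decreasing⇒raised-zigzag : ∀ {s} → Path 1 s → Linked Ascending s → Decreasing (northLabels s) →
    ∃₂ λ G H → northLabels s ≡ G ++ H × s ≡ zigzag G ++ E ∷ zigzag H
  decreasing⇒raised-zigzag {E ∷ s} (east q) l d =
    [] , northLabels s , refl , cong (E ∷_) (decreasing⇒zigzag q (linked-tail l) d)
  decreasing⇒raised-zigzag (north (east q)) (_ ∷ l) (_ ∷ d)
    with G , H , eq , refl ← decreasing⇒raised-zigzag q (linked-tail l) d =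
    _ ∷ G , H , cong (_ ∷_) eq , refl
  decreasing⇒raised-zigzag (north (north _)) (a<b ∷ _) ((b<a ∷ _) ∷ _) =
    contradiction b<a (Fin.<-asym a<b)

  -- Every label of F descends to the next one, so F is traversed by pairs NE; the north step c then
  -- leaves a path at height 1 with decreasing labels B.
  oneAscent⇒bump : ∀ F {c B s} → Path 0 s → Linked Ascending s →
    northLabels s ≡ F ++ c ∷ B → Decreasing (F ∷ʳ c) → Decreasing B →
    ∃₂ λ G H → B ≡ G ++ H × s ≡ bump F c G H
  oneAscent⇒bump []      (north q) l refl _ d
    with G , H , eq , refl ← decreasing⇒raised-zigzag q (linked-tail l) d = G , H , eq , refl
  oneAscent⇒bump (f ∷ F) (north (east q)) (_ ∷ l) eq (_ ∷ dF) dB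
    with refl , eq′ ← ∷-injective eq
    with G , H , B≡ , refl ← oneAscent⇒bump F q (linked-tail l) eq′ dF dB = G , H , B≡ , refl
  oneAscent⇒bump (_ ∷ [])    (north (north _)) (a<b ∷ _) refl ((b<a ∷ _) ∷ _) _ =
    contradiction b<a (Fin.<-asym a<b)
  oneAscent⇒bump (_ ∷ _ ∷ _) (north (north _)) (a<b ∷ _) eq   ((b<a ∷ _) ∷ _) _
    with refl , eq′ ← ∷-injective eq with refl ← ∷-injectiveˡ eq′ =
    contradiction b<a (Fin.<-asym a<b)

  zigzag-E-injective : ∀ G G′ {s s′} → zigzag G ++ E ∷ s ≡ zigzag G′ ++ E ∷ s′ → G ≡ G′
  zigzag-E-injective []      []       _    = refl
  zigzag-E-injective (g ∷ G) (g′ ∷ G′) eq with refl , eq′ ← ∷-injective eq =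
    cong (g ∷_) (zigzag-E-injective G G′ (∷-injectiveʳ eq′))

  -- The equal lengths fix the place of c; for empty G the path is a plain zigzag and would not show
  -- it.
  bump-injective : ∀ F F′ {c c′} G G′ {H H′} → length F ≡ length F′ →
    bump F c G H ≡ bump F′ c′ G′ H′ → c ≡ c′ × G ≡ G′
  bump-injective []      []        G G′ _  eq with refl , eq′ ← ∷-injective eq =
    refl , zigzag-E-injective G G′ eq′
  bump-injective (_ ∷ F) (_ ∷ F′) G G′ len eq =
    bump-injective F F′ G G′ (ℕ.suc-injective len) (∷-injectiveʳ (∷-injectiveʳ eq))

  -- A longer prefix would contain the ascent from c to b. This distinguishes paths with ascents at
  -- different places.
  decreasing-prefix-≤ : ∀ {X Y} F {c b : Fin n} {B} → Decreasing X → c < b →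
    X ++ Y ≡ F ++ c ∷ b ∷ B → ¬ suc (length F) ℕ.< length X
  decreasing-prefix-≤ {_ ∷ []}    []      _               _   _  (s≤s ())
  decreasing-prefix-≤ {_ ∷ _ ∷ _} []      ((b<c ∷ _) ∷ _) c<b refl _ = Fin.<-asym b<c c<b
  decreasing-prefix-≤ {_ ∷ _}     (_ ∷ F) (_ ∷ X↘)        c<b eq (s≤s lt) =
    decreasing-prefix-≤ F X↘ c<b (∷-injectiveʳ eq) lt

-- Counting

unique-length-≡ : ∀ {A : Set} {xs ys : List A} → Unique xs → Unique ys →
  (∀ {v} → v ∈ xs → v ∈ ys) → (∀ {v} → v ∈ ys → v ∈ xs) → length xs ≡ length ys
unique-length-≡ xs! ys! ⊆ ⊇ = ↭-length (∼bag⇒↭ (unique∧set⇒bag xs! ys! (mk⇔ ⊆ ⊇)))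

isPermutation⇒length : ∀ {n} {xs : List (Fin n)} → IsPermutation xs → length xs ≡ n
isPermutation⇒length {n} (xs! , complete) =
  trans (unique-length-≡ xs! (Unique.allFin⁺ n) (λ _ → ∈-allFin _) (λ _ → complete _))
        (length-tabulate id)

length-cartesianProductWith : ∀ {A B C : Set} (f : A → B → C) xs ys →
  length (cartesianProductWith f xs ys) ≡ length xs * length ys
length-cartesianProductWith f []       ys = refl
length-cartesianProductWith f (x ∷ xs) ys =
  trans (length-++ (map (f x) ys))
        (cong₂ _+_ (length-map (f x) ys) (length-cartesianProductWith f xs ys))

2*[n+1]C2 : ∀ n → 2 * (suc n C 2) ≡ suc n * n
2*[n+1]C2 zero    = refl
2*[n+1]C2 (suc n) = begin
  2 * (suc (suc n) C 2)             ≡⟨ cong (2 *_) (nCk+nC[k+1]≡[n+1]C[k+1] (suc n) 1) ⟨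
  2 * ((suc n C 1) + (suc n C 2))   ≡⟨ ℕ.*-distribˡ-+ 2 (suc n C 1) (suc n C 2) ⟩
  2 * (suc n C 1) + 2 * (suc n C 2) ≡⟨ cong₂ _+_ (cong (2 *_) (nC1≡n (suc n))) (2*[n+1]C2 n) ⟩
  2 * suc n + suc n * n             ≡⟨ lemma n ⟩
  suc (suc n) * suc n               ∎
  where
  open ≡-Reasoning
  lemma : ∀ n → 2 * suc n + suc n * n ≡ suc (suc n) * suc n
  lemma = solve-∀

-- The conditions on a counted path, in the recursive forms used by the inductions; the length is
-- recovered in `isSolution⇒length`.
record IsSolution {n} (s : List (Step n)) : Set where
  constructor solution
  field
    path     : Path 0 s
    linked   : Linked Ascending s
    permutes : IsPermutation (northLabels s)
    avoids   : AllTriples AvoidsBoth (northLabels s)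

-- An explicit list of all solutions

module _ {p : ℕ} where

  -- The paths whose labels have their ascent just before the last suc m of them: the labels
  -- before the ascent end in c, and t counts the later north steps preceding the east step
  -- that is missing after c.
  block : ∀ m → Fin (suc m) → Fin (suc (suc m)) → List (Step (suc p))
  block m c t = bump (front m (toℕ c)) (fin (toℕ c))
    (take (toℕ t) (back m (toℕ c))) (drop (toℕ t) (back m (toℕ c)))

  blocks : ℕ → List (List (Step (suc p)))
  blocks m = cartesianProductWith (block m) (allFin (suc m)) (allFin (suc (suc m)))

  ∈-blocks⁻ : ∀ m {s} → s ∈ blocks m → ∃₂ λ c t → s ≡ block m c t
  ∈-blocks⁻ m s∈
    with c , t , _ , _ , eq ←
      ∈-cartesianProductWith⁻ (block m) (allFin (suc m)) (allFin (suc (suc m))) s∈ = c , t , eq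

  length-blocks : ∀ m → length (blocks m) ≡ suc m * suc (suc m)
  length-blocks m = trans
    (length-cartesianProductWith (block m) (allFin (suc m)) (allFin (suc (suc m))))
    (cong₂ _*_ (length-tabulate {n = suc m} id) (length-tabulate {n = suc (suc m)} id))

  -- The path of the decreasing permutation and those with at most m labels after the ascent. Since
  -- A is nonempty, `family p` is the whole list.
  family : ℕ → List (List (Step (suc p)))
  family zero    = zigzag (desc 0 (suc p)) ∷ []
  family (suc m) = blocks m ++ family m

  -- Each step adds (m + 1)(m + 2), twice the binomial coefficient of m + 2 over 2, and Pascal's
  -- rule absorbs it.
  length-family : ∀ m → length (family m) ≡ 2 * (suc (suc m) C 3) + 1
  length-family zero    = refl
  length-family (suc m) = begin
    length (family (suc m))
      ≡⟨ length-++ (blocks m) ⟩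
    length (blocks m) + length (family m)
      ≡⟨ cong₂ _+_ (length-blocks m) (length-family m) ⟩
    suc m * suc (suc m) + (2 * c₃ + 1)
      ≡⟨ cong (_+ (2 * c₃ + 1)) (trans (ℕ.*-comm (suc m) (suc (suc m))) (sym (2*[n+1]C2 (suc m)))) ⟩
    2 * c₂ + (2 * c₃ + 1)
      ≡⟨ ℕ.+-assoc (2 * c₂) _ 1 ⟨
    2 * c₂ + 2 * c₃ + 1
      ≡⟨ cong (_+ 1) (ℕ.*-distribˡ-+ 2 c₂ c₃) ⟨
    2 * (c₂ + c₃) + 1
      ≡⟨ cong (λ c → 2 * c + 1) (nCk+nC[k+1]≡[n+1]C[k+1] (suc (suc m)) 2) ⟩
    2 * (suc (suc (suc m)) C 3) + 1
      ∎
    where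
    open ≡-Reasoning
    c₂ c₃ : ℕ
    c₂ = suc (suc m) C 2
    c₃ = suc (suc m) C 3

  full-decreasing : Decreasing (desc {p} 0 (suc p))
  full-decreasing = desc-decreasing 0 (suc p) (ℕ.≤-reflexive (ℕ.+-identityʳ (suc p)))

  ∈-full : ∀ v → v ∈ desc {p} 0 (suc p)
  ∈-full v = ∈-desc⁺ 0 (suc p) z≤n (subst (toℕ v ℕ.<_) (sym (ℕ.+-identityʳ (suc p))) (Fin.toℕ<n v))

  module _ {m : ℕ} (c : Fin (suc m)) (t : Fin (suc (suc m))) where

    private
      c₀ : ℕ
      c₀ = toℕ c
      F G H : List (Fin (suc p))
      F = front m c₀
      G = take (toℕ t) (back m c₀)
      H = drop (toℕ t) (back m c₀)
      G++H≡back : G ++ H ≡ back m c₀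
      G++H≡back = take++drop≡id (toℕ t) (back m c₀)

    northLabels-block : northLabels (block m c t) ≡ front m c₀ ++ fin c₀ ∷ back m c₀
    northLabels-block = trans (northLabels-bump F G) (cong (λ B → F ++ fin c₀ ∷ B) G++H≡back)

    northLabels-block′ : northLabels (block m c t) ≡ low m c₀ ++ back m c₀
    northLabels-block′ = trans northLabels-block
      (trans (sym (∷ʳ-++ F (fin c₀) (back m c₀))) (cong (_++ back m c₀) (front-∷ʳ m c₀)))

    block-isSolution : m ℕ.< p → IsSolution (block m c t)
    block-isSolution m<p = solution
      (path-bump F G)
      (linked-bump F G (λ eq → back-ascent m<p c≤m (trans (sym G++H≡back) eq)))
      (subst IsPermutation (sym northLabels-block′) (low-back-isPermutation m<p c≤m))
      (subst (AllTriples AvoidsBoth) (sym northLabels-block′) (low-back-allTriples m<p c≤m))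
      where c≤m = ℕ.s≤s⁻¹ (Fin.toℕ<n c)

  family⇒isSolution : ∀ {m s} → m ℕ.≤ p → s ∈ family m → IsSolution s
  family⇒isSolution {zero} _ (here refl) = solution
    (path-zigzag full)
    (linked-zigzag full)
    (subst IsPermutation full≡ (decreasing⇒unique full-decreasing , ∈-full))
    (subst (AllTriples AvoidsBoth) full≡ (convex⇒allTriples [] full-decreasing (λ ())))
    where
    full = desc 0 (suc p)
    full≡ = sym (northLabels-zigzag full)
  family⇒isSolution {suc m} m<p s∈
    with ∈-++⁻ (blocks m) s∈
  ... | inj₂ s∈ = family⇒isSolution (ℕ.<⇒≤ m<p) s∈
  ... | inj₁ s∈ with c , t , refl ← ∈-blocks⁻ m s∈ =
    block-isSolution c t m<p

  block∈family : ∀ {m k} → m ℕ.< k → ∀ c t → block m c t ∈ family k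
  block∈family {m} {suc k} m<1+k c t with ℕ.m≤n⇒m<n∨m≡n (ℕ.s≤s⁻¹ m<1+k)
  ... | inj₁ m<k  = ∈-++⁺ʳ (blocks k)
                      (block∈family m<k c t)
  ... | inj₂ refl = ∈-++⁺ˡ (∈-cartesianProductWith⁺ (block m) (∈-allFin c) (∈-allFin t))

  zigzag∈family : ∀ k → zigzag (desc 0 (suc p)) ∈ family k
  zigzag∈family zero    = here refl
  zigzag∈family (suc k) =
    ∈-++⁺ʳ (blocks k) (zigzag∈family k)

  -- With an ascent present, the labels determine m and c, and the path then gives t as the length
  -- of G.
  isSolution⇒family : ∀ {s : List (Step (suc p))} → IsSolution s → s ∈ family p
  isSolution⇒family {s} (solution q l π@(π! , complete) avoids)
    with allTriples⇒decreasing⊎oneAscent π! avoids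
  ... | inj₁ s↘ = subst (_∈ family p)
    (trans (cong zigzag (decreasing-≡ full-decreasing s↘ (λ _ → complete _) (λ _ → ∈-full _)))
           (sym (decreasing⇒zigzag q l s↘)))
    (zigzag∈family p)
  ... | inj₂ o@(oneAscent F c b rest split F↘ B↘ _ _)
    with lowBack m c₀ m<p c≤m refl refl B≡ ← oneAscent⇒lowBack π o
    with G , H , B≡G++H , refl ←
      oneAscent⇒bump F q l (trans split (∷ʳ-++ F c (b ∷ rest))) F↘ B↘ =
    subst (_∈ family p) block≡ (block∈family m<p (fromℕ< (s≤s c≤m)) (fromℕ< t<))
    where
    back≡ : back m c₀ ≡ G ++ H
    back≡ = trans (sym B≡) B≡G++H
    t< : length G ℕ.< suc (suc m)
    t< = s≤s (ℕ.≤-trans (ℕ.m≤m+n (length G) (length H)) (ℕ.≤-reflexive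
      (trans (sym (length-++ G)) (trans (cong length (sym back≡)) (length-back m<p c≤m)))))
    take-++ : ∀ (xs : List (Fin (suc p))) {ys} → take (length xs) (xs ++ ys) ≡ xs
    take-++ []       = refl
    take-++ (x ∷ xs) = cong (x ∷_) (take-++ xs)
    drop-++ : ∀ (xs : List (Fin (suc p))) {ys} → drop (length xs) (xs ++ ys) ≡ ys
    drop-++ []       = refl
    drop-++ (_ ∷ xs) = drop-++ xs
    block≡ : block m (fromℕ< (s≤s c≤m)) (fromℕ< t<) ≡ bump F c G H
    block≡ rewrite Fin.toℕ-fromℕ< (s≤s c≤m) | Fin.toℕ-fromℕ< t< =
      cong₂ (bump F c) (trans (cong (take (length G)) back≡) (take-++ G))
                       (trans (cong (drop (length G)) back≡) (drop-++ G))

  module _ {m : ℕ} (m<p : m ℕ.< p) where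

    private
      c< : (c : Fin (suc m)) → toℕ c ℕ.< suc p
      c< c = ℕ.<-trans (Fin.toℕ<n c) (s≤s m<p)

      length-take-back : ∀ c (t : Fin (suc (suc m))) →
        length (take (toℕ t) (back m (toℕ {suc m} c))) ≡ toℕ t
      length-take-back c t = trans (length-take (toℕ t) _) (ℕ.m≤n⇒m⊓n≡m
        (subst (toℕ t ℕ.≤_) (sym (length-back m<p (ℕ.s≤s⁻¹ (Fin.toℕ<n c))))
               (ℕ.s≤s⁻¹ (Fin.toℕ<n t))))

    -- The label before the ascent shows c. As t is at most m + 1, the length of `back`, `take`
    -- yields exactly t labels, and their number shows t.
    block-injective : ∀ {c c′ t t′} → block m c t ≡ block m c′ t′ → c ≡ c′ × t ≡ t′
    block-injective {c} {c′} {t} {t′} eq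
      with bump-injective (front m (toℕ c)) (front m (toℕ c′)) _ _
        (trans (length-front {p} m (toℕ c)) (sym (length-front {p} m (toℕ c′)))) eq
    ... | fin≡ , take≡ with refl ← Fin.toℕ-injective
      (trans (sym (toℕ-fin (c< c))) (trans (cong toℕ fin≡) (toℕ-fin (c< c′)))) =
      refl , Fin.toℕ-injective
        (trans (sym (length-take-back c t)) (trans (cong length take≡) (length-take-back c t′)))

  -- At most m labels follow the ascent, so all labels before these are decreasing; the decreasing
  -- permutation is its own prefix.
  family⇒decreasing-prefix : ∀ {m s} → m ℕ.≤ p → s ∈ family m →
    ∃₂ λ X Y → northLabels s ≡ X ++ Y × Decreasing X × suc p ∸ m ℕ.≤ length X
  family⇒decreasing-prefix {zero} _ (here refl) =
    desc 0 (suc p) , [] ,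
    trans (northLabels-zigzag (desc 0 (suc p))) (sym (++-identityʳ _)) ,
    full-decreasing , ℕ.≤-reflexive (sym (length-applyDownFrom _ (suc p)))
  family⇒decreasing-prefix {suc m} m<p s∈
    with ∈-++⁻ (blocks m) s∈
  ... | inj₂ s∈ with X , Y , eq , X↘ , le ← family⇒decreasing-prefix (ℕ.<⇒≤ m<p) s∈ =
    X , Y , eq , X↘ , ℕ.≤-trans (ℕ.∸-monoʳ-≤ (suc p) (ℕ.n≤1+n m)) le
  ... | inj₁ s∈ with c , t , refl ← ∈-blocks⁻ m s∈ =
    low m (toℕ c) , back m (toℕ c) , northLabels-block′ c t ,
    low-decreasing m<p (ℕ.s≤s⁻¹ (Fin.toℕ<n c)) ,
    ℕ.≤-reflexive (trans (ℕ.+-∸-assoc 1 m<p) (sym (length-applyDownFrom _ (suc (p ∸ suc m)))))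

  family-unique : ∀ {m} → m ℕ.≤ p → Unique (family m)
  family-unique {zero}  _   = [] ∷ []
  family-unique {suc m} m<p = Unique.++⁺
    (Unique.cartesianProductWith⁺ (block m) (block-injective m<p)
      (Unique.allFin⁺ (suc m)) (Unique.allFin⁺ (suc (suc m))))
    (family-unique (ℕ.<⇒≤ m<p))
    disjoint
    where
    -- In `blocks m` the ascent comes right after the first p - m labels, while in `family m` the
    -- first p + 1 - m labels are decreasing.
    disjoint : ∀ {s} → ¬ (s ∈ blocks m
                          × s ∈ family m)
    disjoint (s∈block , s∈family)
      with c , t , refl ← ∈-blocks⁻ m s∈block
      with X , Y , eq , X↘ , le ← family⇒decreasing-prefix (ℕ.<⇒≤ m<p) s∈family =
      decreasing-prefix-≤ (front m (toℕ c)) X↘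
        (back-ascent m<p (ℕ.s≤s⁻¹ (Fin.toℕ<n c)) refl)
        (trans (sym eq) (northLabels-block c t))
        (ℕ.≤-trans (ℕ.≤-reflexive short) le)
      where
      short : suc (suc (length (front {p} m (toℕ c)))) ≡ suc p ∸ m
      short = begin
        suc (suc (length (front {p} m (toℕ c))))
          ≡⟨ cong (2 +_) (length-front {p} m (toℕ c)) ⟩
        suc (suc (p ∸ suc m)) ≡⟨ cong suc (ℕ.+-∸-assoc 1 m<p) ⟨
        suc (p ∸ m)           ≡⟨ ℕ.+-∸-assoc 1 (ℕ.<⇒≤ m<p) ⟨
        suc p ∸ m             ∎
        where open ≡-Reasoning

-- From solutions to parking functions

patterns : List (∃ Permutation)
patterns = (3 , π123) ∷ (3 , π312) ∷ []

module _ {n : ℕ} where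

  AvoidsPatterns : LabelledPath n → Set
  AvoidsPatterns w = All (λ (_ , ρ) → Avoids (φ w) (oneLine ρ)) patterns

  isSolution⁺ : ∀ {w : LabelledPath n} → IsParkingFunction w → AvoidsPatterns w →
    IsSolution (toList w)
  isSolution⁺ {w} ((norths≡n , easts≡n , above) , π , linked) (a123 ∷ a312 ∷ []) = solution
    (path⁺ (trans easts≡n (sym norths≡n)) above) linked π
    (Equivalence.to (avoids⇔allTriples (φ w)) (a123 , a312))

  isSolution⁻ : ∀ {w : LabelledPath n} → IsSolution (toList w) →
    IsParkingFunction w × AvoidsPatterns w
  isSolution⁻ {w} (solution path linked π avoids)
    with easts≡norths , above ← path⁻ path
    with a123 , a312 ← Equivalence.from (avoids⇔allTriples (φ w)) avoids =
    ((norths≡n , trans easts≡norths norths≡n , above) , π , linked) , a123 ∷ a312 ∷ []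
    -- The number of north steps is the number of labels; that of east steps follows because the
    -- path ends on the diagonal.
    where norths≡n = isPermutation⇒length π

  isSolution⇒length : ∀ {s : List (Step n)} → IsSolution s → length s ≡ n + n
  isSolution⇒length {s} (solution path _ π _) = trans (length-steps s)
    (cong₂ _+_ (isPermutation⇒length π) (trans (proj₁ (path⁻ path)) (isPermutation⇒length π)))

toList-surjective : ∀ {A : Set} {k} (xs : List A) → length xs ≡ k → ∃ λ (w : Vec A k) → toList w ≡ xs
toList-surjective xs refl = fromList xs , Vec.toList∘fromList xs

-- This bridges the vectors counted by `pf` and the lists in `family`: `toList` is injective, so
-- duplicate-free lists stay so under it.
length-filter-toList : ∀ {A : Set} {k} {P : Vec A k → Set} (P? : Decidable P)
  {ws : List (Vec A k)} {xss : List (List A)} → Unique ws → Unique xss →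
  (∀ {w} → w ∈ ws → P w → toList w ∈ xss) →
  (∀ {xs} → xs ∈ xss → ∃ λ w → toList w ≡ xs × w ∈ ws × P w) →
  length (filter P? ws) ≡ length xss
length-filter-toList P? {ws} {xss} ws! xss! to from = trans
  (sym (length-map toList (filter P? ws)))
  (unique-length-≡ (Unique.map⁺ toList-injective (Unique.filter⁺ P? ws!)) xss! ⊆ ⊇)
  where
  toList-injective : ∀ {v w} → toList v ≡ toList w → v ≡ w
  toList-injective {v} {w} eq =
    trans (sym (Vec.cast-is-id refl v)) (Vec.toList-injective refl v w eq)
  ⊆ : ∀ {xs} → xs ∈ map toList (filter P? ws) → xs ∈ xss
  ⊆ xs∈ with w , w∈ , refl ← ∈-map⁻ toList xs∈
    with w∈ws , Pw ← ∈-filter⁻ P? {xs = ws} w∈ = to w∈ws Pw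
  ⊇ : ∀ {xs} → xs ∈ xss → xs ∈ map toList (filter P? ws)
  ⊇ xs∈ with w , refl , w∈ws , Pw ← from xs∈ = ∈-map⁺ toList (∈-filter⁺ P? w∈ws Pw)

theorem19 : ∀ (n : ℕ) → n ≥ 1 →
    pf n ((3 , π123) ∷ (3 , π312) ∷ []) ≡ 2 * ((n + 1) C 3) + 1
theorem19 n@(suc p) _ = begin
  pf n patterns
    ≡⟨ length-filter-toList (λ w → all? (λ (_ , ρ) → avoids? (φ w) (oneLine ρ)) patterns)
         (parkingFunctions-unique n) (family-unique ℕ.≤-refl) to from ⟩
  length (family p)     ≡⟨ length-family p ⟩
  2 * ((2 + p) C 3) + 1 ≡⟨ cong (λ k → 2 * (k C 3) + 1) (ℕ.+-comm 1 n) ⟩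
  2 * ((n + 1) C 3) + 1 ∎
  where
  open ≡-Reasoning
  to : ∀ {w : LabelledPath n} → w ∈ parkingFunctions n → AvoidsPatterns w → toList w ∈ family p
  to {w} w∈ avoids =
    isSolution⇒family (isSolution⁺ (Equivalence.to (∈-parkingFunctions w) w∈) avoids)
  from : ∀ {s} → s ∈ family p →
    ∃ λ (w : LabelledPath n) → toList w ≡ s × w ∈ parkingFunctions n × AvoidsPatterns w
  from {s} s∈ with sol ← family⇒isSolution ℕ.≤-refl s∈
    with w , refl ← toList-surjective s (isSolution⇒length sol)
    with parking , avoids ← isSolution⁻ {w = w} sol =
    w , refl , Equivalence.from (∈-parkingFunctions w) parking , avoids
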